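{- Let $\Sigma$ be a finite alphabet. An $\omega$-regular language $L\subseteq\Sigma^\omega$ is positional over state-labelled arenas if and only if it can be played optimally with memory of the previous label in edge-labelled arenas.
   Context: **Arenas.** An arena has disjoint finite sets $V_1,V_2$ of states controlled by Player 1 and Player 2; $V=V_1\sqcup V_2$. A state-labelled arena has a total edge relation $\delta\subseteq V\times V$ and a labelling $\pi:V\to\Sigma$. An edge-labelled arena has a total edge relation $\delta\subseteq V\times\Sigma\times V$. (Total: every state has an outgoing edge.) $src(e)$, $tgt(e)$ are the source and target of an edge $e$, and $col(e)=c$ for $e=(v,c,v')$. **Strategies.** A strategy is a function $\sigma:V\cup\delta^+\to\delta$ with $src(\sigma(v))=v$ for $v\in V$ and $src(\sigma(we))=tgt(e)$ for $w\in\delta^*$, $e\in\delta$. A positional strategy is a function $\sigma:V\to\delta$ with $src(\sigma(v))=v$. Strategies $\sigma_1,\sigma_2$ and an initial state $q$ determine a play $\varsigma\in\delta^\omega$: if the current state lies in $V_i$, the next edge is given by $\sigma_i$ applied to the history of edges so far (to $q$ at the first step; to the current state if $\sigma_i$ is positional). The trace is $\pi(src(\varsigma[0]))\pi(src(\varsigma[1]))\cdots$ in state-labelled arenas and $col(\varsigma[0])col(\varsigma[1])\cdots$ in edge-labelled arenas. A strategy $\sigma_1$ is winning for Player 1 from $q$ with objective $L$ if for every strategy $\sigma_2$ the trace of the play from $q$ lies in $L$. **Positional over state-labelled arenas.** For every state-labelled arena, every $W\subseteq V$, and every strategy winning for Player 1 (objective $L$) from all states of $W$, there is a single positional strategy winning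 for Player 1 from all states of $W$. **Memory of the previous label.** In an edge-labelled arena, a strategy with memory of the previous label is a function $\sigma:V\cup(V\times\Sigma)\to\delta$ with $src(\sigma(v))=v$ and $src(\sigma(v,c))=v$: at the first step from initial state $q$ it plays $\sigma(q)$, and later, at current state $v$ with the last traversed edge labelled $c$, it plays $\sigma(v,c)$. $L$ can be played optimally with memory of the previous label in edge-labelled arenas if for every edge-labelled arena, every $W\subseteq V$, and every strategy winning for Player 1 (objective $L$) from all states of $W$, there is a single strategy with memory of the previous label winning for Player 1 from all states of $W$. -}

module Defs where

open import Data.Bool using (Bool; T)
open import Data.Fin using (Fin)
open import Data.List using (List; []; _∷ʳ_)
open import Data.Nat using (ℕ; zero; suc; _≤_)
open import Data.Product using (∃; ∃-syntax; Σ-syntax; _×_; _,_; proj₁; proj₂)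
open import Data.Sum using (_⊎_; inj₁; inj₂)
open import Function using (_∘_; _↔_)
open import Level using (Level; 0ℓ; _⊔_) renaming (suc to lsuc)
open import Relation.Binary.PropositionalEquality using (_≡_)
open import Relation.Unary using (Pred; _≐_)

private
  variable
    ℓ : Level

Finite : Set → Set
Finite A = ∃[ n ] (A ↔ Fin n)

-- Subsets of, and relations between, finite sets are given by their
-- characteristic functions.  The proofs of membership `T b` are then unique, so
-- that the edge types below contain each edge exactly once.

Subset : Set → Set
Subset A = A → Bool

infix 8 _^ω

_^ω : Set → Set
Σ ^ω = ℕ → Σ

Language : Set → (ℓ : Level) → Set (lsuc ℓ)
Language Σ ℓ = Pred (Σ ^ω) ℓ

-- ω-regular languages, as those recognised by nondeterministic Büchi automata.

record BüchiAutomaton (Σ : Set) : Set₁ where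
  field
    Q         : Set
    Q-finite  : Finite Q
    initial   : Subset Q
    Δ         : Q → Σ → Q → Bool
    accepting : Subset Q

  record AcceptingRun (w : Σ ^ω) : Set where
    field
      run       : ℕ → Q
      starts    : T (initial (run 0))
      steps     : ∀ n → T (Δ (run n) (w n) (run (suc n)))
      recurrent : ∀ n → ∃[ m ] (n ≤ m × T (accepting (run m)))

  Recognised : Language Σ 0ℓ
  Recognised = AcceptingRun

ωRegular : {Σ : Set} → Language Σ ℓ → Set (lsuc 0ℓ ⊔ ℓ)
ωRegular {Σ = Σ} L = Σ[ 𝒜 ∈ BüchiAutomaton Σ ] (L ≐ BüchiAutomaton.Recognised 𝒜)

-- What the two kinds of arena have in common: plays are sequences of edges, and
-- `label e` is the letter that traversing `e` contributes to the trace.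

record GameGraph (Σ : Set) : Set₁ where
  field
    V₁ V₂ : Set

  V : Set
  V = V₁ ⊎ V₂

  field
    Edge    : Set
    src tgt : Edge → V
    label   : Edge → Σ

module Games {Σ : Set} (G : GameGraph Σ) where
  open GameGraph G

  -- A function on V ∪ δ⁺ is split into its restrictions to V and to δ⁺, and a
  -- word of δ⁺ into `w e` with w ∈ δ* (in chronological order) and e its last
  -- edge.

  record Strategy : Set where
    field
      first     : V → Edge
      next      : List Edge → Edge → Edge
      src-first : ∀ v → src (first v) ≡ v
      src-next  : ∀ w e → src (next w e) ≡ tgt e

  record PositionalStrategy : Set where
    field
      move     : V → Edge
      src-move : ∀ v → src (move v) ≡ v

    strategy : Strategy
    strategy = record
      { first     = move
      ; next      = λ w e → move (tgt e)
      ; src-first = src-move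
      ; src-next  = λ w e → src-move (tgt e)
      }

  -- The memory holds the label of the last traversed edge.

  record LastLabelStrategy : Set where
    field
      first     : V → Edge
      next      : V → Σ → Edge
      src-first : ∀ v → src (first v) ≡ v
      src-next  : ∀ v c → src (next v c) ≡ v

    strategy : Strategy
    strategy = record
      { first     = first
      ; next      = λ w e → next (tgt e) (label e)
      ; src-first = src-first
      ; src-next  = λ w e → src-next (tgt e) (label e)
      }

  module _ (σ₁ σ₂ : Strategy) where

    strategyAt : V → Strategy
    strategyAt (inj₁ _) = σ₁
    strategyAt (inj₂ _) = σ₂

    -- `history q n` is the pair of ς[0] … ς[n-1] and ς[n].

    history : V → ℕ → List Edge × Edge
    history q zero    = [] , Strategy.first (strategyAt q) q
    history q (suc n) =
      let (w , e) = history q n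
      in  w ∷ʳ e , Strategy.next (strategyAt (tgt e)) w e

    play : V → ℕ → Edge
    play q n = proj₂ (history q n)

    trace : V → Σ ^ω
    trace q = label ∘ play q

  Winning₁ : Language Σ ℓ → Strategy → V → Set ℓ
  Winning₁ L σ₁ q = ∀ (σ₂ : Strategy) → L (trace σ₁ σ₂ q)

  WinningOn₁ : Language Σ ℓ → Strategy → Subset V → Set ℓ
  WinningOn₁ L σ₁ W = ∀ q → T (W q) → Winning₁ L σ₁ q

record StateLabelledArena (Σ : Set) : Set₁ where
  field
    V₁ V₂     : Set
    V₁-finite : Finite V₁
    V₂-finite : Finite V₂

  V : Set
  V = V₁ ⊎ V₂

  field
    δ     : V → V → Bool
    total : ∀ v → ∃[ v′ ] T (δ v v′)
    π     : V → Σ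

  Edge : Set
  Edge = Σ[ (v , v′) ∈ V × V ] T (δ v v′)

  graph : GameGraph Σ
  graph = record
    { V₁    = V₁
    ; V₂    = V₂
    ; Edge  = Edge
    ; src   = λ ((v , v′) , _) → v
    ; tgt   = λ ((v , v′) , _) → v′
    ; label = λ ((v , v′) , _) → π v
    }

  open Games graph public

record EdgeLabelledArena (Σ : Set) : Set₁ where
  field
    V₁ V₂     : Set
    V₁-finite : Finite V₁
    V₂-finite : Finite V₂

  V : Set
  V = V₁ ⊎ V₂

  field
    δ     : V → Σ → V → Bool
    total : ∀ v → ∃[ c ] ∃[ v′ ] T (δ v c v′)

  Edge : Set
  Edge = Σ[ (v , c , v′) ∈ V × Σ × V ] T (δ v c v′)

  graph : GameGraph Σ
  graph = record
    { V₁    = V₁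
    ; V₂    = V₂
    ; Edge  = Edge
    ; src   = λ ((v , c , v′) , _) → v
    ; tgt   = λ ((v , c , v′) , _) → v′
    ; label = λ ((v , c , v′) , _) → c
    }

  open Games graph public

PositionalOverStateLabelled : {Σ : Set} → Language Σ ℓ → Set (lsuc 0ℓ ⊔ ℓ)
PositionalOverStateLabelled {Σ = Σ} L =
  ∀ (𝒜 : StateLabelledArena Σ) → let open StateLabelledArena 𝒜 in
  ∀ (W : Subset V) (σ : Strategy) → WinningOn₁ L σ W →
  Σ[ τ ∈ PositionalStrategy ] WinningOn₁ L (PositionalStrategy.strategy τ) W

OptimalWithPreviousLabel : {Σ : Set} → Language Σ ℓ → Set (lsuc 0ℓ ⊔ ℓ)
OptimalWithPreviousLabel {Σ = Σ} L =
  ∀ (𝒜 : EdgeLabelledArena Σ) → let open EdgeLabelledArena 𝒜 in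
  ∀ (W : Subset V) (σ : Strategy) → WinningOn₁ L σ W →
  Σ[ τ ∈ LastLabelStrategy ] WinningOn₁ L (LastLabelStrategy.strategy τ) W

{-# OPTIONS --safe #-}

-- Winning is first rephrased through plays: σ wins from q exactly when every
-- infinite path from q that agrees with σ at Player 1's states has its trace
-- in L.  Only paths and Player 1's strategies then have to be translated.
--
-- From edge labels to state labels, the new states are pairs (v , c) of a state
-- and the last label, with π (v , c) = c.  As L need not be prefix-independent,
-- the play from q is read from its second state on: the trace from (v , c) is
-- that of a play whose first edge is some (q , c , v).  A strategy winning on W
-- thus wins from all (v , c) reached by an edge from W that it allows.
--
-- From state labels to edge labels, each edge carries the label of its target,
-- so that the last label is a function of the current state, and a fresh copy of
-- each q with a single edge to q supplies the first letter.

module Submission where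

open import Defs
open import Data.Bool using (Bool; true; false; T; if_then_else_)
open import Data.Bool.Properties using (T-irrelevant; T?) renaming (_≟_ to _≟ᵇ_)
open import Data.Empty using (⊥)
open import Data.Fin.Properties using (any?; inj⇒≟; +↔⊎; *↔×; 2↔Bool)
open import Data.List using (List; []; _∷_; _∷ʳ_; _++_; map; length)
open import Data.List.Properties using (map-++; length-++)
open import Data.Nat using (ℕ; zero; suc; _+_)
open import Data.Nat.Properties using (+-comm)
open import Data.Product using (∃; ∃-syntax; _×_; _,_; proj₁; proj₂)
open import Data.Product.Function.NonDependent.Propositional using (_×-↔_)
open import Data.Sum using (_⊎_; inj₁; inj₂; [_,_]′)
import Data.Sum as Sum
open import Data.Sum.Function.Propositional using (_⊎-↔_)
open import Data.Unit using (⊤; tt)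
open import Function using (_∘_; _⇔_; mk⇔; Inverse)
open import Function.Properties.Inverse using (↔⇒↣; ↔-sym; ↔-trans)
open import Level using (Level)
open import Relation.Binary using (DecidableEquality)
open import Relation.Binary.PropositionalEquality
  using (_≡_; refl; sym; trans; cong; cong₂; subst; subst₂; _≗_)
open import Relation.Nullary using (Dec; yes; no; contradiction)
open import Relation.Nullary.Decidable
  using (⌊_⌋; True; toWitness; fromWitness; map′; _×-dec_; _→-dec_)
open import Relation.Unary using (Decidable)

private
  variable
    ℓ : Level
    A B C : Set

-- Finite types and decidable search

finite-⊎ : Finite A → Finite B → Finite (A ⊎ B)
finite-⊎ (m , f) (n , g) = m + n , ↔-trans (f ⊎-↔ g) (↔-sym +↔⊎)

finite-× : Finite A → Finite B → Finite (A × B)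
finite-× (m , f) (n , g) = _ , ↔-trans (f ×-↔ g) (↔-sym *↔×)

finite-Bool : Finite Bool
finite-Bool = 2 , ↔-sym 2↔Bool

finite⇒≟ : Finite A → DecidableEquality A
finite⇒≟ (n , f) = inj⇒≟ (↔⇒↣ f)

finite-any? : Finite A → {P : A → Set} → Decidable P → Dec (∃ P)
finite-any? (n , f) {P} P? =
  map′ (λ (i , x) → from i , x)
       (λ (a , x) → to a , subst P (sym (strictlyInverseʳ a)) x)
       (any? (P? ∘ from))
  where open Inverse f

-- Yields the very witness stored in the decision, so that functions defined by cases on `d` can be
-- evaluated at it.
True⇒yes : (d : Dec A) → True d → ∃[ a ] d ≡ yes a
True⇒yes (yes a) _ = a , refl

-- Languages closed under pointwise equality

Extensional : {Σ : Set} → Language Σ ℓ → Set ℓ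
Extensional L = ∀ {w w′} → w ≗ w′ → L w → L w′

-- An automaton reads its word letter by letter, so the same run serves every pointwise equal word.
ωRegular⇒extensional : {Σ : Set} (L : Language Σ ℓ) → ωRegular L → Extensional L
ωRegular⇒extensional L (𝒜 , L⊆ , ⊆L) w≗w′ w∈L = ⊆L (record
  { run       = run
  ; starts    = starts
  ; steps     = λ n → subst (λ c → T (Δ (run n) c (run (suc n)))) (w≗w′ n) (steps n)
  ; recurrent = recurrent
  })
  where
  open BüchiAutomaton 𝒜
  open AcceptingRun (L⊆ w∈L)

-- Prefixes of infinite sequences

prefix : (ℕ → A) → ℕ → List A
prefix p zero    = []
prefix p (suc n) = prefix p n ∷ʳ p n

length-prefix : (p : ℕ → A) → ∀ n → length (prefix p n) ≡ n
length-prefix p zero    = refl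
length-prefix p (suc n) = trans (length-++ (prefix p n))
  (trans (+-comm _ 1) (cong suc (length-prefix p n)))

prefix-map : (f : A → B) (p : ℕ → A) → ∀ n → prefix (f ∘ p) n ≡ map f (prefix p n)
prefix-map f p zero    = refl
prefix-map f p (suc n) = trans (cong (_∷ʳ f (p n)) (prefix-map f p n))
                               (sym (map-++ f (prefix p n) (p n ∷ [])))

infixr 5 _∷ω_

_∷ω_ : A → (ℕ → A) → ℕ → A
(a ∷ω p) zero    = a
(a ∷ω p) (suc n) = p n

prefix-∷ω : (a : A) (p : ℕ → A) → ∀ n → prefix (a ∷ω p) (suc n) ≡ a ∷ prefix p n
prefix-∷ω a p zero    = refl
prefix-∷ω a p (suc n) = cong (_∷ʳ p n) (prefix-∷ω a p n)

-- Ownership of states, and states paired with a tag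

Player₁ : A ⊎ B → Set
Player₁ = [ (λ _ → ⊤) , (λ _ → ⊥) ]′

player₁? : (v : A ⊎ B) → Dec (Player₁ v)
player₁? (inj₁ _) = yes tt
player₁? (inj₂ _) = no λ ()

module _ {A B C : Set} where

  -- The product of the state set with `C`, kept as a sum because an arena lists the two players'
  -- states separately; tagging preserves the owner.
  tag : A ⊎ B → C → (A × C) ⊎ (B × C)
  tag v c = Sum.map (_, c) (_, c) v

  untag : (A × C) ⊎ (B × C) → A ⊎ B
  untag = Sum.map proj₁ proj₁

  tagOf : (A × C) ⊎ (B × C) → C
  tagOf = [ proj₂ , proj₂ ]′

  untag-tag : ∀ v c → untag (tag v c) ≡ v
  untag-tag (inj₁ _) c = refl
  untag-tag (inj₂ _) c = refl

  tagOf-tag : ∀ v c → tagOf (tag v c) ≡ c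
  tagOf-tag (inj₁ _) c = refl
  tagOf-tag (inj₂ _) c = refl

  tag-untag : ∀ s → tag (untag s) (tagOf s) ≡ s
  tag-untag (inj₁ _) = refl
  tag-untag (inj₂ _) = refl

  tag-≡ : ∀ {v c} s → untag s ≡ v → tagOf s ≡ c → s ≡ tag v c
  tag-≡ s refl refl = sym (tag-untag s)

  tag-player₁ : ∀ v c → Player₁ (tag v c) → Player₁ v
  tag-player₁ (inj₁ _) c _ = tt

  untag-player₁ : ∀ s → Player₁ (untag s) → Player₁ s
  untag-player₁ (inj₁ _) _ = tt

-- Winning in terms of consistent paths

module Paths {Σ : Set} (G : GameGraph Σ) where
  open GameGraph G
  open Games G

  -- No opposing strategy occurs: Player 2's edges are constrained by adjacency alone.
  record ConsistentPath (σ : Strategy) (q : V) (p : ℕ → Edge) : Set where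
    field
      starts     : src (p 0) ≡ q
      continues  : ∀ n → src (p (suc n)) ≡ tgt (p n)
      plays-first : Player₁ q → p 0 ≡ Strategy.first σ q
      plays-next  : ∀ n → Player₁ (tgt (p n)) →
                    p (suc n) ≡ Strategy.next σ (prefix p n) (p n)

  history-prefix : ∀ σ₁ σ₂ q n → proj₁ (history σ₁ σ₂ q n) ≡ prefix (play σ₁ σ₂ q) n
  history-prefix σ₁ σ₂ q zero    = refl
  history-prefix σ₁ σ₂ q (suc n) =
    cong (_∷ʳ play σ₁ σ₂ q n) (history-prefix σ₁ σ₂ q n)

  play-consistent : ∀ σ₁ σ₂ q → ConsistentPath σ₁ q (play σ₁ σ₂ q)
  play-consistent σ₁ σ₂ q = record
    { starts      = Strategy.src-first (strategyAt σ₁ σ₂ q) q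
    ; continues   = λ n → Strategy.src-next (strategyAt σ₁ σ₂ (tgt (play σ₁ σ₂ q n))) _ _
    ; plays-first = first q
    ; plays-next  = λ n own → trans (next (tgt (play σ₁ σ₂ q n)) own)
        (cong (λ w → Strategy.next σ₁ w (play σ₁ σ₂ q n)) (history-prefix σ₁ σ₂ q n))
    }
    where
    first : ∀ v {u} → Player₁ v →
            Strategy.first (strategyAt σ₁ σ₂ v) u ≡ Strategy.first σ₁ u
    first (inj₁ _) _ = refl
    next : ∀ v {w e} → Player₁ v →
           Strategy.next (strategyAt σ₁ σ₂ v) w e ≡ Strategy.next σ₁ w e
    next (inj₁ _) _ = refl

  module _ (_≟_ : DecidableEquality V) where

    -- A strategy must answer every history with a legal edge; the default is taken where the
    -- intended edge does not leave `v`.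
    moveFrom : V → (preferred default : Edge) → Edge
    moveFrom v e d = if ⌊ src e ≟ v ⌋ then e else d

    src-moveFrom : ∀ v e d → src d ≡ v → src (moveFrom v e d) ≡ v
    src-moveFrom v e d d-from with src e ≟ v
    ... | yes e-from = e-from
    ... | no  _      = d-from

    moveFrom-preferred : ∀ v e d → src e ≡ v → moveFrom v e d ≡ e
    moveFrom-preferred v e d e-from with src e ≟ v
    ... | yes _  = refl
    ... | no ¬eq = contradiction e-from ¬eq

    -- The opponent that replays `p`, looking only at how many edges have been played.
    follow : Strategy → (ℕ → Edge) → Strategy
    follow σ p = record
      { first     = λ v → moveFrom v (p 0) (first v)
      -- The history `w e` has `suc (length w)` edges, which is therefore the index of the next one;
      -- the move of `σ` is merely a legal default.
      ; next      = λ w e → moveFrom (tgt e) (p (suc (length w))) (next w e)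
      ; src-first = λ v → src-moveFrom v _ _ (src-first v)
      ; src-next  = λ w e → src-moveFrom (tgt e) _ _ (src-next w e)
      }
      where open Strategy σ

    module _ {σ q p} (con : ConsistentPath σ q p) where
      open ConsistentPath con

      private
        σ₂ = follow σ p

        first≡ : ∀ v → (Player₁ v → p 0 ≡ Strategy.first σ v) → src (p 0) ≡ v →
                 Strategy.first (strategyAt σ σ₂ v) v ≡ p 0
        first≡ (inj₁ _) own _    = sym (own tt)
        first≡ (inj₂ _) _   from = moveFrom-preferred _ _ _ from

        next≡ : ∀ n v → (Player₁ v → p (suc n) ≡ Strategy.next σ (prefix p n) (p n)) →
                Strategy.next (strategyAt σ σ₂ v) (prefix p n) (p n) ≡ p (suc n)
        next≡ n (inj₁ _) own = sym (own tt)
        next≡ n (inj₂ _) _   rewrite length-prefix p n =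
          moveFrom-preferred _ _ _ (continues n)

      -- At Player 1's states `p` obeys `σ`, at Player 2's states the opponent replays `p`; so the
      -- play is `p` by induction.
      history-follow : ∀ n → history σ σ₂ q n ≡ (prefix p n , p n)
      history-follow zero    = cong ([] ,_) (first≡ q plays-first starts)
      history-follow (suc n) rewrite history-follow n =
        cong (prefix p (suc n) ,_) (next≡ n (tgt (p n)) (plays-next n))

    module _ (L : Language Σ ℓ) where

      winning⇒path : Extensional L → ∀ {σ q p} →
                     Winning₁ L σ q → ConsistentPath σ q p → L (label ∘ p)
      winning⇒path ext {σ} {p = p} wins con =
        ext (λ n → cong (label ∘ proj₂) (history-follow con n)) (wins (follow σ p))

  path⇒winning : (L : Language Σ ℓ) → ∀ {σ q} →
                 (∀ p → ConsistentPath σ q p → L (label ∘ p)) → Winning₁ L σ q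
  path⇒winning L {σ} {q} wins σ₂ = wins _ (play-consistent σ σ₂ q)

-- Edges with equal endpoints and labels are equal

stateEdge-≡ : {Σ : Set} (𝒜 : StateLabelledArena Σ) → let open StateLabelledArena 𝒜 in
              ∀ {e e′ : Edge} → proj₁ e ≡ proj₁ e′ → e ≡ e′
stateEdge-≡ 𝒜 {p , t} {.p , t′} refl = cong (p ,_) (T-irrelevant t t′)

edgeEdge-≡ : {Σ : Set} (𝒜 : EdgeLabelledArena Σ) → let open EdgeLabelledArena 𝒜 in
             ∀ {e e′ : Edge} → proj₁ e ≡ proj₁ e′ → e ≡ e′
edgeEdge-≡ 𝒜 {p , t} {.p , t′} refl = cong (p ,_) (T-irrelevant t t′)

-- From edge-labelled to state-labelled arenas

module ToStateLabels {Σ : Set} (Σ-finite : Finite Σ) (𝒜 : EdgeLabelledArena Σ) where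
  open EdgeLabelledArena 𝒜
  open GameGraph graph using (src; tgt; label)

  ℬ : StateLabelledArena Σ
  ℬ = record
    { V₁        = V₁ × Σ
    ; V₂        = V₂ × Σ
    ; V₁-finite = finite-× V₁-finite Σ-finite
    ; V₂-finite = finite-× V₂-finite Σ-finite
    -- The letter of a step is stored in the state it enters, so traces run one edge behind.
    ; δ         = λ s s′ → δ (untag s) (tagOf s′) (untag s′)
    ; total     = λ s → let (c , v , t) = total (untag s) in
        tag v c , subst₂ (λ c v → T (δ (untag s) c v))
                    (sym (tagOf-tag v c)) (sym (untag-tag v c)) t
    ; π         = tagOf
    }

  module ℬ where
    open StateLabelledArena ℬ public
    open GameGraph (StateLabelledArena.graph ℬ) using (src; tgt; label) public

  V-finite : Finite V
  V-finite = finite-⊎ V₁-finite V₂-finite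

  _≟ᵛ_ : DecidableEquality V
  _≟ᵛ_ = finite⇒≟ V-finite

  -- The argument `b` is the label remembered at the source, which the edge itself does not
  -- determine.
  lift : Σ → Edge → ℬ.Edge
  lift b ((v , c , v′) , t) = (tag v b , tag v′ c) , t⁺
    where
    t⁺ : T (δ (untag (tag v b)) (tagOf (tag v′ c)) (untag (tag v′ c)))
    t⁺ rewrite untag-tag v b | tagOf-tag v′ c | untag-tag v′ c = t

  lower : ℬ.Edge → Edge
  lower ((s , s′) , t) = (untag s , tagOf s′ , untag s′) , t

  lower-lift : ∀ b e → lower (lift b e) ≡ e
  lower-lift b ((v , c , v′) , t) = edgeEdge-≡ 𝒜
    (cong₂ _,_ (untag-tag v b) (cong₂ _,_ (tagOf-tag v′ c) (untag-tag v′ c)))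

  lift-lower : ∀ {b} e → ℬ.label e ≡ b → lift b (lower e) ≡ e
  lift-lower ((s , s′) , t) refl = stateEdge-≡ ℬ (cong₂ _,_ (tag-untag s) (tag-untag s′))

  -- Opening edges and the translation of the given strategy

  module _ (W : Subset V) (σ : Strategy) where
    open Strategy σ

    -- The edge from `q` into `s` can begin a play from `W`: the last clause makes it the choice of
    -- `σ` when `q` is Player 1's.
    Opening : ℬ.V → Set
    Opening s = ∃[ q ] (T (W q) × T (δ q (tagOf s) (untag s)) ×
      (Player₁ q → label (first q) ≡ tagOf s × tgt (first q) ≡ untag s))

    -- Besides deciding, the search fixes one `q` for each opening `s`; its edge then serves as the
    -- imagined past of plays from `s`.
    opening? : ∀ s → Dec (Opening s)
    opening? s = finite-any? V-finite λ q →
      T? (W q) ×-dec T? (δ q (tagOf s) (untag s)) ×-dec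
      (player₁? q →-dec (finite⇒≟ Σ-finite (label (first q)) (tagOf s)
                         ×-dec (tgt (first q) ≟ᵛ untag s)))

    openingEdge : ∀ s → Opening s → Edge
    openingEdge s (q , _ , t , _) = (q , tagOf s , untag s) , t

    openings : Subset ℬ.V
    openings s = ⌊ opening? s ⌋

    -- The decision is an explicit argument so that an equation `opening? s ≡ yes o` can be
    -- substituted for it.
    pastOf : ∀ s → Dec (Opening s) → List Edge
    pastOf s (yes o) = openingEdge s o ∷ []
    pastOf s (no _)  = []

    past : ℬ.V → List Edge
    past s = pastOf s (opening? s)

    firstAt : ∀ s → Dec (Opening s) → Edge
    firstAt s (yes o) = next [] (openingEdge s o)
    -- Outside the openings any legal edge will do.
    firstAt s (no _)  = first (untag s)

    src-firstAt : ∀ s d → src (firstAt s d) ≡ untag s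
    src-firstAt s (yes o) = src-next [] (openingEdge s o)
    src-firstAt s (no _)  = src-first (untag s)

    initialState : List ℬ.Edge → ℬ.Edge → ℬ.V
    initialState []      e = ℬ.src e
    initialState (x ∷ _) e = ℬ.src x

    initialState-prefix : ∀ p n → initialState (prefix p n) (p n) ≡ ℬ.src (p 0)
    initialState-prefix p zero          = refl
    initialState-prefix p (suc zero)    = refl
    initialState-prefix p (suc (suc n)) =
      trans (snoc (prefix p n)) (initialState-prefix p (suc n))
      where
      snoc : ∀ w {x y z} → initialState ((w ∷ʳ x) ∷ʳ y) z ≡ initialState (w ∷ʳ x) y
      snoc []      = refl
      snoc (_ ∷ _) = refl

    -- Plays as `σ` does after the imagined opening edge followed by the lowered history. The
    -- initial state, read off the history, tells which opening edge to prepend.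
    σ⁺ : ℬ.Strategy
    σ⁺ = record
      { first     = λ s → lift (tagOf s) (firstAt s (opening? s))
      ; next      = λ w e → lift (label (lower e))
          (next (past (initialState w e) ++ map lower w) (lower e))
      ; src-first = λ s → sym (tag-≡ s (sym (src-firstAt s (opening? s))) refl)
      ; src-next  = λ w e → sym (tag-≡ (ℬ.tgt e) (sym (src-next _ (lower e))) refl)
      }

    private
      module P  = Paths graph
      module P⁺ = Paths ℬ.graph

    prepend-opening : ∀ {s p} (o : Opening s) → opening? s ≡ yes o →
      P⁺.ConsistentPath σ⁺ s p →
      P.ConsistentPath σ (proj₁ o) (openingEdge s o ∷ω lower ∘ p)
    prepend-opening {s} {p} o@(q , _ , _ , agrees) eq con = record
      { starts      = refl
      ; continues   = λ { zero    → cong untag starts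
                        ; (suc n) → cong untag (continues n) }
      ; plays-first = λ own → let (c≡ , v≡) = agrees own in
          edgeEdge-≡ 𝒜 (cong₂ _,_ (sym (src-first q)) (cong₂ _,_ (sym c≡) (sym v≡)))
      ; plays-next  = λ
          -- The first move of `σ⁺` is the reply of `σ` to the opening edge; `eq` ensures that this
          -- edge comes from `o`.
          { zero own → trans
              (cong lower (plays-first (untag-player₁ s own)))
              (trans (lower-lift _ _) (cong (firstAt s) eq))
          ; (suc n) own → trans
              (cong lower (plays-next n (untag-player₁ (ℬ.tgt (p n)) own)))
              (trans (lower-lift _ _) (cong (λ w → next w (lower (p n))) (past≡ n)))
          }
      }
      where
      open P⁺.ConsistentPath con
      past-s : ∀ {t} → t ≡ s → past t ≡ openingEdge s o ∷ []
      past-s refl = cong (pastOf s) eq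
      past≡ : ∀ n → past (initialState (prefix p n) (p n)) ++ map lower (prefix p n)
                    ≡ prefix (openingEdge s o ∷ω lower ∘ p) (suc n)
      past≡ n = trans
        (cong₂ _++_ (past-s (trans (initialState-prefix p n) starts))
                    (sym (prefix-map lower p n)))
        (sym (prefix-∷ω _ _ n))

    σ⁺-winning : (L : Language Σ ℓ) → Extensional L →
                 WinningOn₁ L σ W → ℬ.WinningOn₁ L σ⁺ openings
    σ⁺-winning L ext wins s s∈ with True⇒yes (opening? s) s∈
    ... | o@(q , q∈W , _) , eq = P⁺.path⇒winning L λ p con →
      let open P⁺.ConsistentPath con in
      -- The source of each edge of `p` stores the label of the edge before it, which is the opening
      -- edge at position 0; hence both traces agree.
      ext (λ { zero    → sym (cong tagOf starts)
             ; (suc n) → sym (cong tagOf (continues n)) })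
          (P.winning⇒path _≟ᵛ_ L ext (wins q q∈W) (prepend-opening o eq con))

    -- Back to a strategy with memory of the previous label

    module _ (τ : ℬ.PositionalStrategy) where
      open ℬ.PositionalStrategy τ using (move; src-move)

      τ⁻ : LastLabelStrategy
      τ⁻ = record
        -- Keeping the first move of `σ` makes the state entered by it an opening, where `τ` wins.
        { first     = first
        ; next      = λ v c → lower (move (tag v c))
        ; src-first = src-first
        ; src-next  = λ v c → trans (cong untag (src-move (tag v c))) (untag-tag v c)
        }

      -- The first edge disappears; only its label survives, stored in the state where the new path
      -- starts.
      lift-path : (ℕ → Edge) → ℕ → ℬ.Edge
      lift-path p n = lift (label (p n)) (p (suc n))

      drop-opening : ∀ {q p} → P.ConsistentPath (LastLabelStrategy.strategy τ⁻) q p →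
        P⁺.ConsistentPath (ℬ.PositionalStrategy.strategy τ)
          (tag (tgt (p 0)) (label (p 0))) (lift-path p)
      drop-opening {p = p} con = record
        { starts      = starts⁺ 0
        ; continues   = λ n → starts⁺ (suc n)
        ; plays-first = moves 0
        ; plays-next  = λ n → moves (suc n)
        }
        where
        open P.ConsistentPath con
        starts⁺ : ∀ n → ℬ.src (lift-path p n) ≡ tag (tgt (p n)) (label (p n))
        starts⁺ n = cong (λ v → tag v (label (p n))) (continues n)
        moves : ∀ n → Player₁ (tag (tgt (p n)) (label (p n))) →
                lift-path p n ≡ move (tag (tgt (p n)) (label (p n)))
        moves n own = trans
          (cong (lift (label (p n))) (plays-next n (tag-player₁ (tgt (p n)) _ own)))
          (lift-lower _ (trans (cong tagOf (src-move _)) (tagOf-tag (tgt (p n)) _)))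

      opens : ∀ {q p} → T (W q) → P.ConsistentPath (LastLabelStrategy.strategy τ⁻) q p →
              Opening (tag (tgt (p 0)) (label (p 0)))
      opens {q} {p} q∈W con = q , q∈W ,
        subst T (trans (cong (λ v → δ v c (tgt (p 0))) starts)
                       (cong₂ (δ q) (sym c≡) (sym v≡))) (proj₂ (p 0)) ,
        λ own → trans (cong label (sym (plays-first own))) (sym c≡) ,
                trans (cong tgt (sym (plays-first own))) (sym v≡)
        where
        open P.ConsistentPath con
        c  = label (p 0)
        c≡ = tagOf-tag (tgt (p 0)) c
        v≡ = untag-tag (tgt (p 0)) c

      τ⁻-winning : (L : Language Σ ℓ) → Extensional L →
        ℬ.WinningOn₁ L (ℬ.PositionalStrategy.strategy τ) openings →
        WinningOn₁ L (LastLabelStrategy.strategy τ⁻) W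
      τ⁻-winning L ext wins q q∈W = P.path⇒winning L λ p con →
        -- The edges are shifted by one and the labels lag by one, so the shifts cancel.
        ext (λ n → tagOf-tag (src (p (suc n))) (label (p n)))
          (P⁺.winning⇒path (finite⇒≟ (finite-⊎ ℬ.V₁-finite ℬ.V₂-finite)) L ext
            (wins _ (fromWitness (opens q∈W con))) (drop-opening con))

-- From state-labelled to edge-labelled arenas

module ToEdgeLabels {Σ : Set} (Σ-finite : Finite Σ) (𝒜 : StateLabelledArena Σ) where
  open StateLabelledArena 𝒜
  open GameGraph graph using (src; tgt; label)

  V-finite : Finite V
  V-finite = finite-⊎ V₁-finite V₂-finite

  _≟ᵛ_ : DecidableEquality V
  _≟ᵛ_ = finite⇒≟ V-finite

  V⁺ : Set
  V⁺ = (V₁ × Bool) ⊎ (V₂ × Bool)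

  -- The tag `true` marks the fresh copies.

  start old : V → V⁺
  start v = tag v true
  old   v = tag v false

  From : Bool → V → V → Set
  From true  u v = u ≡ v
  From false u v = T (δ u v)

  from? : ∀ b u v → Dec (From b u v)
  from? true  u v = u ≟ᵛ v
  from? false u v = T? (δ u v)

  -- Every target is an old state, so a fresh copy is never entered and occurs only at the start of
  -- a path.
  Step : V⁺ → Σ → V⁺ → Set
  Step s c t = tagOf t ≡ false × c ≡ π (untag t) × From (tagOf s) (untag s) (untag t)

  step? : ∀ s c t → Dec (Step s c t)
  step? s c t = (tagOf t ≟ᵇ false) ×-dec finite⇒≟ Σ-finite c (π (untag t))
                ×-dec from? (tagOf s) (untag s) (untag t)

  tagged-step : ∀ b {u v} → From b u v → Step (tag u b) (π v) (old v)
  tagged-step b {u} {v} x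
    rewrite untag-tag u b | tagOf-tag u b | untag-tag v false | tagOf-tag v false =
    refl , refl , x

  successor : ∀ b u → ∃[ v ] From b u v
  successor true  u = u , refl
  successor false u = total u

  ℬ : EdgeLabelledArena Σ
  ℬ = record
    { V₁        = V₁ × Bool
    ; V₂        = V₂ × Bool
    ; V₁-finite = finite-× V₁-finite finite-Bool
    ; V₂-finite = finite-× V₂-finite finite-Bool
    ; δ         = λ s c t → ⌊ step? s c t ⌋
    ; total     = λ s → let (v , x) = successor (tagOf s) (untag s) in
        π v , old v , fromWitness (subst (λ s → Step s (π v) (old v)) (tag-untag s)
                                         (tagged-step (tagOf s) x))
    }

  module ℬ where
    open EdgeLabelledArena ℬ public
    open GameGraph (EdgeLabelledArena.graph ℬ) using (src; tgt; label) public

  _≟⁺_ : DecidableEquality V⁺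
  _≟⁺_ = finite⇒≟ (finite-⊎ ℬ.V₁-finite ℬ.V₂-finite)

  step : (e : ℬ.Edge) → Step (ℬ.src e) (ℬ.label e) (ℬ.tgt e)
  step (_ , t) = toWitness t

  label-tgt : ∀ e → ℬ.label e ≡ π (untag (ℬ.tgt e))
  label-tgt e = proj₁ (proj₂ (step e))

  tgt-old : ∀ e → ℬ.tgt e ≡ old (untag (ℬ.tgt e))
  tgt-old e = tag-≡ (ℬ.tgt e) refl (proj₁ (step e))

  -- The label and the tag of the target are forced by the target's underlying state.
  ℬ-edge-≡ : ∀ {e e′} → ℬ.src e ≡ ℬ.src e′ → untag (ℬ.tgt e) ≡ untag (ℬ.tgt e′) → e ≡ e′
  ℬ-edge-≡ {e} {e′} src≡ tgt≡ = edgeEdge-≡ ℬ (cong₂ _,_ src≡ (cong₂ _,_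
    (trans (label-tgt e) (trans (cong π tgt≡) (sym (label-tgt e′))))
    (trans (tgt-old e) (trans (cong old tgt≡) (sym (tgt-old e′))))))

  startEdge : V → ℬ.Edge
  startEdge q = (start q , π q , old q) , fromWitness (tagged-step true refl)

  embed : Edge → ℬ.Edge
  embed ((v , v′) , t) = (old v , π v′ , old v′) , fromWitness (tagged-step false t)

  start-tgt : ∀ {q} e → ℬ.src e ≡ start q → untag (ℬ.tgt e) ≡ q
  start-tgt {q} e refl = sym (go (proj₂ (proj₂ (step e))))
    where
    go : From (tagOf (start q)) (untag (start q)) (untag (ℬ.tgt e)) → q ≡ untag (ℬ.tgt e)
    go x rewrite tagOf-tag {C = Bool} q true | untag-tag q true = x

  start-unique : ∀ {q} e → ℬ.src e ≡ start q → e ≡ startEdge q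
  start-unique {q} e eq = ℬ-edge-≡ eq (trans (start-tgt e eq) (sym (untag-tag q false)))

  -- On the edges leaving the fresh copies the value is irrelevant.

  lower : ℬ.Edge → Edge
  lower e@((s , _ , t) , _) with tagOf s | proj₂ (proj₂ (step e))
  ... | false | x = (untag s , untag t) , x
  ... | true  | _ = let (v , x) = total (untag s) in (untag s , v) , x

  src-lower : ∀ e → src (lower e) ≡ untag (ℬ.src e)
  src-lower e@((s , _ , t) , _) with tagOf s | proj₂ (proj₂ (step e))
  ... | false | x = refl
  ... | true  | _ = refl

  tgt-lower : ∀ e → tagOf (ℬ.src e) ≡ false → tgt (lower e) ≡ untag (ℬ.tgt e)
  tgt-lower e@((s , _ , t) , _) eq with tagOf s | proj₂ (proj₂ (step e))
  tgt-lower e@((s , _ , t) , _) refl | false | x = refl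

  embed-lower : ∀ e → tagOf (ℬ.src e) ≡ false → embed (lower e) ≡ e
  embed-lower e eq = ℬ-edge-≡
    (sym (tag-≡ (ℬ.src e) (sym (src-lower e)) eq))
    (trans (untag-tag (tgt (lower e)) false) (tgt-lower e eq))

  lower-embed : ∀ e → lower (embed e) ≡ e
  lower-embed e@((v , v′) , _) = stateEdge-≡ 𝒜 (cong₂ _,_
    (trans (src-lower (embed e)) (untag-tag v false))
    (trans (tgt-lower (embed e) (tagOf-tag v false)) (untag-tag v′ false)))

  -- Translation of the given strategy to plays from fresh copies

  module _ (W : Subset V) (σ : Strategy) where
    open Strategy σ

    starts : Subset V⁺
    starts s = if tagOf s then W (untag s) else false

    private
      module P  = Paths graph
      module P⁺ = Paths ℬ.graph

    start⊆starts : ∀ {q} → T (W q) → T (starts (start q))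
    start⊆starts {q} q∈W rewrite tagOf-tag {C = Bool} q true | untag-tag q true = q∈W

    starts⊆start : ∀ s → T (starts s) → ∃[ q ] (T (W q) × s ≡ start q)
    starts⊆start s s∈ with tagOf s in eq
    ... | true = untag s , s∈ , tag-≡ s refl eq

    firstMove : ∀ s → ∃[ e ] ℬ.src e ≡ s
    firstMove s = let (c , t , x) = ℬ.total s in ((s , c , t) , x) , refl

    -- The first edge of a history only leaves the fresh copy and is discarded; after that edge
    -- alone, `σ` makes its first move.
    nextMove : List ℬ.Edge → ℬ.Edge → Edge
    nextMove []      e = first (untag (ℬ.tgt e))
    nextMove (_ ∷ w) e = next (map lower w) (lower e)

    σ⁺ : ℬ.Strategy
    σ⁺ = record
      { first     = λ s → proj₁ (firstMove s)
      -- The default is taken only if `e` leaves a fresh copy without being the first edge, which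
      -- happens on no path.
      ; next      = λ w e → P⁺.moveFrom _≟⁺_ (ℬ.tgt e) (embed (nextMove w e))
                              (proj₁ (firstMove (ℬ.tgt e)))
      ; src-first = λ s → proj₂ (firstMove s)
      ; src-next  = λ w e → P⁺.src-moveFrom _≟⁺_ (ℬ.tgt e) (embed (nextMove w e)) _
                              (proj₂ (firstMove (ℬ.tgt e)))
      }

    drop-start : ∀ {q p} → P⁺.ConsistentPath σ⁺ (start q) p →
                 P.ConsistentPath σ q (lower ∘ p ∘ suc)
    drop-start {q} {p} con = record
      { starts      = trans (src-after 0) q≡
      ; continues   = λ n → trans (src-after (suc n)) (sym (tgt-after n))
      ; plays-first = λ own → trans
          (cong lower (moves 0 refl (subst Player₁ (sym q≡) own) (src-first _)))
          (trans (lower-embed _) (cong first q≡))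
      ; plays-next  = λ n own → trans
          (cong lower (moves (suc n) (prefix-suc n) (subst Player₁ (tgt-after n) own)
            (trans (src-next _ (lower (p (suc n)))) (tgt-after n))))
          (trans (lower-embed _)
            (cong (λ w → next w (lower (p (suc n)))) (sym (prefix-map lower (p ∘ suc) n))))
      }
      where
      open P⁺.ConsistentPath con renaming (starts to starts′)
      q≡ : untag (ℬ.tgt (p 0)) ≡ q
      q≡ = start-tgt (p 0) starts′
      src-after : ∀ n → src (lower (p (suc n))) ≡ untag (ℬ.tgt (p n))
      src-after n = trans (src-lower (p (suc n))) (cong untag (continues n))
      tgt-after : ∀ n → tgt (lower (p (suc n))) ≡ untag (ℬ.tgt (p (suc n)))
      tgt-after n = tgt-lower (p (suc n))
        (trans (cong tagOf (continues n)) (proj₁ (step (p n))))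
      prefix-suc : ∀ n → prefix p (suc n) ≡ p 0 ∷ prefix (p ∘ suc) n
      prefix-suc zero    = refl
      prefix-suc (suc n) = cong (_∷ʳ p (suc n)) (prefix-suc n)
      -- The prefix is generalised to `w` so that `nextMove` computes once `w` is known to be empty
      -- or a cons.
      moves : ∀ n {w} → prefix p n ≡ w → Player₁ (untag (ℬ.tgt (p n))) →
              src (nextMove w (p n)) ≡ untag (ℬ.tgt (p n)) →
              p (suc n) ≡ embed (nextMove w (p n))
      moves n refl own from = trans
        (plays-next n (untag-player₁ (ℬ.tgt (p n)) own))
        (P⁺.moveFrom-preferred _≟⁺_ _ (embed (nextMove (prefix p n) (p n)))
          (proj₁ (firstMove (ℬ.tgt (p n)))) (trans (cong old from) (sym (tgt-old (p n)))))

    σ⁺-winning : (L : Language Σ ℓ) → Extensional L →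
                 WinningOn₁ L σ W → ℬ.WinningOn₁ L σ⁺ starts
    σ⁺-winning L ext wins s s∈ with starts⊆start s s∈
    ... | q , q∈W , refl = P⁺.path⇒winning L λ p con →
      let open P⁺.ConsistentPath con in
      -- The state at which edge `suc n` starts is the target of edge `n`, whose label is that
      -- state's letter.
      ext (λ n → trans (cong π (trans (src-lower (p (suc n))) (cong untag (continues n))))
                       (sym (label-tgt (p n))))
          (P.winning⇒path _≟ᵛ_ L ext (wins q q∈W) (drop-start con))

    -- Back to a positional strategy

    module _ (τ : ℬ.LastLabelStrategy) where
      module τ = ℬ.LastLabelStrategy τ

      -- Whenever `old v` is reached, the last label is `π v`, so the memory is a function of the
      -- state.
      τ⁻ : PositionalStrategy
      τ⁻ = record
        { move     = λ v → lower (τ.next (old v) (π v))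
        ; src-move = λ v → trans (src-lower (τ.next (old v) (π v)))
                      (trans (cong untag (τ.src-next (old v) (π v))) (untag-tag v false))
        }

      open PositionalStrategy τ⁻ using (move)

      prepend-start : ∀ {q p} → P.ConsistentPath (PositionalStrategy.strategy τ⁻) q p →
        P⁺.ConsistentPath τ.strategy (start q) (startEdge q ∷ω embed ∘ p)
      prepend-start {q} {p} con = record
        { starts      = refl
        ; continues   = λ { zero    → cong old starts′
                          ; (suc n) → cong old (continues n) }
        -- A fresh copy has a single outgoing edge, so the first move of `τ` is forced.
        ; plays-first = λ _ → sym (start-unique _ (τ.src-first (start q)))
        ; plays-next  = λ
            { zero own    → moves q (plays-first (tag-player₁ q _ own))
            ; (suc n) own → moves (tgt (p n)) (plays-next n (tag-player₁ (tgt (p n)) _ own))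
            }
        }
        where
        open P.ConsistentPath con renaming (starts to starts′)
        moves : ∀ v {e} → e ≡ move v → embed e ≡ τ.next (old v) (π v)
        moves v refl = embed-lower _
          (trans (cong tagOf (τ.src-next (old v) (π v))) (tagOf-tag v false))

      τ⁻-winning : (L : Language Σ ℓ) → Extensional L →
        ℬ.WinningOn₁ L τ.strategy starts →
        WinningOn₁ L (PositionalStrategy.strategy τ⁻) W
      τ⁻-winning L ext wins q q∈W = P.path⇒winning L λ p con →
        let open P.ConsistentPath con renaming (starts to starts′) in
        -- Edge `n` of the extended path is labelled by its target, which is the source of `p n`;
        -- the start edge gives the letter of `q`.
        ext (λ { zero    → cong π (sym starts′)
               ; (suc n) → cong π (sym (continues n)) })
          (P⁺.winning⇒path _≟⁺_ L ext (wins (start q) (start⊆starts q∈W))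
            (prepend-start con))

-- The two implications combined

module _ {Σ : Set} (Σ-finite : Finite Σ) (L : Language Σ ℓ) (ext : Extensional L) where

  positional⇒previousLabel : PositionalOverStateLabelled L → OptimalWithPreviousLabel L
  positional⇒previousLabel positional 𝒜 W σ wins = τ⁻ W σ τ , τ⁻-winning W σ τ L ext τ-wins
    where
    open ToStateLabels Σ-finite 𝒜
    solution = positional ℬ (openings W σ) (σ⁺ W σ) (σ⁺-winning W σ L ext wins)
    τ        = proj₁ solution
    τ-wins   = proj₂ solution

  previousLabel⇒positional : OptimalWithPreviousLabel L → PositionalOverStateLabelled L
  previousLabel⇒positional optimal 𝒜 W σ wins = τ⁻ W σ τ , τ⁻-winning W σ τ L ext τ-wins
    where
    open ToEdgeLabels Σ-finite 𝒜
    solution = optimal ℬ (starts W σ) (σ⁺ W σ) (σ⁺-winning W σ L ext wins)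
    τ        = proj₁ solution
    τ-wins   = proj₂ solution

proposition25 : ∀ {ℓ : Level} {Σ : Set} → Finite Σ → (L : Language Σ ℓ) → ωRegular L →
    PositionalOverStateLabelled L ⇔ OptimalWithPreviousLabel L
proposition25 Σ-finite L regular = mk⇔
  (positional⇒previousLabel Σ-finite L ext)
  (previousLabel⇒positional Σ-finite L ext)
  where ext = ωRegular⇒extensional L regular
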